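{- There are constants $c_0,c_1,c_2\ge 1$ and an infinite set of integers $k\ge c_0$ such that for each such $k$ there is a class $\mathcal{G}_k$ of graphs of treewidth at most $k$ with the following property: for any $G\in\mathcal{G}_k$ and any $V\subseteq V(G)$ with $|V|\ge k^{c_1}$, the partial matching width of $V$ in $G$ is at least $(k\log|V|)/c_2$.
   Context: For a graph $G$ and $V\subseteq V(G)$, the partial matching width of $V$ (w.r.t. $G$) is the largest $k$ such that every permutation (linear ordering) $SV$ of $V$ has a prefix $SV'$ such that $G$ has a matching of size at least $k$ each of whose edges has one end in $SV'$ (viewed as a set) and the other end in $V(G)\setminus SV'$. -}

module Defs where

open import Level using (0ℓ)
open import Data.Nat using (ℕ; zero; suc; _+_; _*_; _^_; _≤_)
import Data.Fin
open import Data.Fin using (Fin; toℕ)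
open import Data.Fin.Subset using (Subset; _∈_; _∉_; ∣_∣)
import Data.List
open import Data.List using (List; length; take)
import Data.List.Membership.Propositional as LM
open import Data.List.Relation.Unary.Unique.Propositional using (Unique)
open import Data.List.Relation.Unary.All using (All)
open import Data.Product using (Σ; ∃; _×_; _,_; proj₁; proj₂)
open import Relation.Binary.PropositionalEquality using (_≡_)
open import Relation.Binary.Construct.Closure.ReflexiveTransitive using (Star)
open import Function.Bundles using (_⇔_)
open import Relation.Nullary using (¬_)

record Graph : Set₁ where
  field
    n      : ℕ
    Adj    : Fin n → Fin n → Set
    sym    : ∀ {u v} → Adj u v → Adj v u
    irrefl : ∀ {u} → ¬ Adj u u
open Graph public

-- Trees, represented as rooted trees on nodes Fin (suc t) (root = node 0),
-- where node (suc i) is joined to its parent 'parent i', which has a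
-- smaller index.  Every finite tree is (isomorphic to) one of these.

record Tree : Set where
  field
    t       : ℕ
    parent  : Fin t → Fin (suc t)
    parent< : ∀ i → toℕ (parent i) ≤ toℕ i
open Tree public

data TreeAdj (T : Tree) : Fin (suc (t T)) → Fin (suc (t T)) → Set where
  up   : ∀ i → TreeAdj T (Data.Fin.suc i) (parent T i)
  down : ∀ i → TreeAdj T (parent T i) (Data.Fin.suc i)

AdjIn : (T : Tree) → (Fin (suc (t T)) → Set) → Fin (suc (t T)) → Fin (suc (t T)) → Set
AdjIn T P x y = TreeAdj T x y × P x × P y

ConnectedIn : (T : Tree) → (Fin (suc (t T)) → Set) → Set
ConnectedIn T P = ∀ x y → P x → P y → Star (AdjIn T P) x y

record TreeDecomposition (G : Graph) (k : ℕ) : Set where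
  field
    tree       : Tree
    bag        : Fin (suc (t tree)) → Subset (n G)
    bagSize    : ∀ x → ∣ bag x ∣ ≤ suc k
    covVertex  : ∀ v → ∃ λ x → v ∈ bag x
    covEdge    : ∀ u v → Adj G u v → ∃ λ x → (u ∈ bag x) × (v ∈ bag x)
    connected  : ∀ v → ConnectedIn tree (λ x → v ∈ bag x)

TreewidthAtMost : Graph → ℕ → Set
TreewidthAtMost G k = TreeDecomposition G k

IsOrderingOf : {m : ℕ} → List (Fin m) → Subset m → Set
IsOrderingOf {m} L V = Unique L × (∀ (v : Fin m) → (LM._∈_ v L) ⇔ (v ∈ V))

-- A matching of G of size s each of whose edges has one end in the set
-- S (given as a list) and the other end outside S.  Edges are listed as
-- pairs (inside end, outside end); distinct edges share no endpoint
-- (inside ends are pairwise distinct, outside ends are pairwise distinct,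
-- and inside/outside ends differ as one set is S and the other its complement).
record CrossMatching (G : Graph) (S : List (Fin (n G))) (s : ℕ) : Set where
  field
    edges     : List (Fin (n G) × Fin (n G))
    size      : length edges ≡ s
    adj       : All (λ e → Adj G (proj₁ e) (proj₂ e)) edges
    inS       : All (λ e → LM._∈_ (proj₁ e) S) edges
    outS      : All (λ e → ¬ LM._∈_ (proj₂ e) S) edges
    distinct₁ : Unique (Data.List.map proj₁ edges)
    distinct₂ : Unique (Data.List.map proj₂ edges)

-- "The partial matching width of V w.r.t. G is at least s":
-- every ordering of V has a prefix SV' such that G has a matching of
-- size at least s (equivalently, exactly s) between SV' and V(G)∖SV'.
-- Since this property is downward closed in s, pmw(V) ≥ s iff it holds.
PMWAtLeast : (G : Graph) → Subset (n G) → ℕ → Set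
PMWAtLeast G V s =
  ∀ (L : List (Fin (n G))) → IsOrderingOf L V →
    ∃ λ i → i ≤ length L × CrossMatching G (take i L) s

{-# OPTIONS --safe #-}
module Submission where

-- The graph is the complete ternary tree with every node blown up to a clique
-- of 2s vertices and every edge to a complete bipartite graph; k = 4s.
-- Bags consisting of a node and its parent give the tree decomposition.
--
-- If V contains a whole subtree of height h, any ordering of V has a prefix cut
-- by a matching of size s(h+1): at the median of the times found for the three
-- child subtrees, the middle child is cut well, while the other two contain s
-- vertices inside, respectively outside, the prefix, and this forces s further
-- matching edges avoiding the middle child.
--
-- If V contains no such subtree, then the boundary of V is large: V itself is
-- cut by a matching of size at least |V| / 2C, where C is the number of vertices
-- of a subtree of height h.  With h = ⌊log₂|V|⌋ / 4 this exceeds s(h+1).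

open import Defs
open import Data.Nat using (ℕ; _*_; _^_; _≤_)
open import Data.Nat.Logarithm using (⌊log₂_⌋)
open import Data.Fin.Subset using (Subset; ∣_∣)
open import Data.Product using (Σ; ∃; _×_)

open import Algebra.Properties.CommutativeSemigroup using () renaming (interchange to medial)
open import Data.Bool using (Bool; true; false; not)
import Data.Bool as Bool
open import Data.Bool.Properties using (¬-not)
open import Data.Empty using (⊥; ⊥-elim)
open import Data.Fin as Fin using (Fin; zero; suc; toℕ; combine; remQuot)
open import Data.Fin.Properties as Finₚ using (combine-injective; combine-remQuot; remQuot-combine; toℕ-combine)
open import Data.Fin.Patterns using (0F; 1F; 2F)
import Data.Fin.Subset as Sub
open import Data.Fin.Subset.Properties using (∣p∣≤n)
open import Data.List using (List; []; _∷_; _++_; map; length; take; drop; filter; tabulate; concatMap)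
open import Data.List.Properties using (length-++; length-map; length-tabulate; length-take; map-++; take-map; take-all; take++drop≡id; filter-++; filter-accept; filter-reject)
open import Data.List.Membership.Propositional using (_∈_; find; lose)
open import Data.List.Membership.Propositional.Properties
open import Data.List.Membership.DecPropositional using () renaming (_∈?_ to mem?)
open import Data.List.Relation.Unary.All as All using (All; []; _∷_)
import Data.List.Relation.Unary.All.Properties as Allₚ
open import Data.List.Relation.Unary.Any as Any using (here; there)
open import Data.List.Relation.Unary.AllPairs using ([]; _∷_)
open import Data.List.Relation.Unary.Unique.Propositional using (Unique)
import Data.List.Relation.Unary.Unique.Propositional.Properties as Uniqueₚ
open import Data.Nat using (zero; suc; _+_; _∸_; _<_; z≤n; s≤s; NonZero; >-nonZero; >-nonZero⁻¹; ⌊_/2⌋; ⌈_/2⌉)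
open import Data.Nat.DivMod using (_/_; _%_; m≡m%n+[m/n]*n; m%n≤n; m/n*n≤m)
open import Data.Nat.Induction using (<-rec)
open import Data.Nat.Logarithm using (⌊log₂⌊n/2⌋⌋≡⌊log₂n⌋∸1)
open import Data.Nat.Properties
open import Data.Nat.Solver using (module +-*-Solver)
open import Data.Product using (_,_; proj₁; proj₂)
open import Data.Sum using (_⊎_; inj₁; inj₂; [_,_]; swap)
open import Data.Unit using (⊤; tt)
import Data.Vec as Vec
import Data.Vec.Properties as Vecₚ
open import Function using (_∘_; id; case_of_)
open import Function.Bundles using (Equivalence)
open import Relation.Binary.Construct.Closure.ReflexiveTransitive using (Star; ε; _◅_; _◅◅_)
open import Relation.Binary.PropositionalEquality as ≡ using (_≡_; _≢_; refl; cong; cong₂; subst; trans)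
open import Relation.Nullary using (¬_; Dec; yes; no; does; contradiction)
open import Relation.Nullary.Decidable using (dec-true; dec-false; from-yes)

-- Lists and subsets

-- Pigeonhole by deletion: one occurrence of the head is cut out of `ys`, and uniqueness keeps the
-- tail of `xs` inside what remains.
Unique-⊆⇒length≤ : ∀ {A : Set} {xs ys : List A} → Unique xs → (∀ {x} → x ∈ xs → x ∈ ys) →
                   length xs ≤ length ys
Unique-⊆⇒length≤ {xs = []} _ _ = z≤n
Unique-⊆⇒length≤ {xs = x ∷ xs} {ys} uxs@(_ ∷ u) sub with as , bs , eq ← ∈-∃++ (sub (here refl)) = begin
  suc (length xs)            ≤⟨ s≤s (Unique-⊆⇒length≤ u sub′) ⟩
  suc (length (as ++ bs))    ≡⟨ cong suc (length-++ as) ⟩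
  suc (length as + length bs) ≡⟨ +-suc (length as) (length bs) ⟨
  length as + length (x ∷ bs) ≡⟨ length-++ as ⟨
  length (as ++ x ∷ bs)      ≡⟨ cong length eq ⟨
  length ys                  ∎
  where
  open ≤-Reasoning
  sub′ : ∀ {y} → y ∈ xs → y ∈ as ++ bs
  sub′ {y} y∈xs with ∈-++⁻ as (subst (y ∈_) eq (sub (there y∈xs)))
  ... | inj₁ p           = ∈-++⁺ˡ p
  ... | inj₂ (here refl) = contradiction y∈xs (Uniqueₚ.Unique[x∷xs]⇒x∉xs uxs)
  ... | inj₂ (there p)   = ∈-++⁺ʳ as p

length-take-≤ : ∀ {A : Set} {m} {xs : List A} → m ≤ length xs → length (take m xs) ≡ m
length-take-≤ {m = m} {xs} m≤ = trans (length-take m xs) (m≤n⇒m⊓n≡m m≤)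

take-mono-∈ : ∀ {A : Set} {i j} → i ≤ j → ∀ (xs : List A) {x} → x ∈ take i xs → x ∈ take j xs
take-mono-∈ (s≤s i≤j) (x ∷ xs) (here eq)  = here eq
take-mono-∈ (s≤s i≤j) (x ∷ xs) (there x∈) = there (take-mono-∈ i≤j xs x∈)

∈-drop⁻ : ∀ {A : Set} i {xs : List A} {x} → x ∈ drop i xs → x ∈ xs
∈-drop⁻ zero            x∈ = x∈
∈-drop⁻ (suc i) {_ ∷ _} x∈ = there (∈-drop⁻ i x∈)

take-drop-disjoint : ∀ {A : Set} i {xs : List A} → Unique xs → ∀ {x} → x ∈ take i xs → x ∈ drop i xs → ⊥
take-drop-disjoint (suc i) {_ ∷ _} u       (here refl) x∈d = Uniqueₚ.Unique[x∷xs]⇒x∉xs u (∈-drop⁻ i x∈d)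
take-drop-disjoint (suc i) {_ ∷ _} (_ ∷ u) (there x∈t) x∈d = take-drop-disjoint i u x∈t x∈d

-- A discrete intermediate value theorem: lengthening the prefix by one entry raises the count by at
-- most one, so no value is skipped.
filter-prefix : ∀ {A : Set} {P : A → Set} (P? : ∀ x → Dec (P x)) xs {m} → m ≤ length (filter P? xs) →
                ∃ λ i → i ≤ length xs × length (filter P? (take i xs)) ≡ m
filter-prefix P? xs {zero} _ = 0 , z≤n , refl
filter-prefix P? (x ∷ xs) {suc m} m≤ with P? x
... | yes px with i , i≤ , len ← filter-prefix P? xs (≤-pred m≤) =
  suc i , s≤s i≤ , trans (cong length (filter-accept P? px)) (cong suc len)
... | no ¬px with i , i≤ , len ← filter-prefix P? xs m≤ =
  suc i , s≤s i≤ , trans (cong length (filter-reject P? ¬px)) len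

members : ∀ {m} → Subset m → List (Fin m)
members Vec.[]            = []
members (true Vec.∷ p)  = zero ∷ map suc (members p)
members (false Vec.∷ p) = map suc (members p)

length-members : ∀ {m} (p : Subset m) → length (members p) ≡ ∣ p ∣
length-members Vec.[]            = refl
length-members (true Vec.∷ p)  = cong suc (trans (length-map suc (members p)) (length-members p))
length-members (false Vec.∷ p) = trans (length-map suc (members p)) (length-members p)

members-unique : ∀ {m} (p : Subset m) → Unique (members p)
members-unique Vec.[]            = []
members-unique (true Vec.∷ p)  =
  Allₚ.map⁺ (All.universal (λ _ ()) (members p)) ∷ Uniqueₚ.map⁺ Finₚ.suc-injective (members-unique p)
members-unique (false Vec.∷ p) = Uniqueₚ.map⁺ Finₚ.suc-injective (members-unique p)

∈-members⁻ : ∀ {m} (p : Subset m) {v} → v ∈ members p → v Sub.∈ p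
∈-members⁻ (true Vec.∷ p) (here refl) = Vec.here
∈-members⁻ (true Vec.∷ p) (there v∈) with w , w∈ , refl ← ∈-map⁻ suc v∈ = Vec.there (∈-members⁻ p w∈)
∈-members⁻ (false Vec.∷ p) v∈ with w , w∈ , refl ← ∈-map⁻ suc v∈ = Vec.there (∈-members⁻ p w∈)

∣p∣≤length : ∀ {m} (p : Subset m) (xs : List (Fin m)) → (∀ {v} → v Sub.∈ p → v ∈ xs) → ∣ p ∣ ≤ length xs
∣p∣≤length p xs sub = subst (_≤ length xs) (length-members p)
  (Unique-⊆⇒length≤ (members-unique p) (sub ∘ ∈-members⁻ p))

module _ {m} {P : Fin m → Set} (P? : ∀ v → Dec (P v)) where

  comprehension : Subset m
  comprehension = Vec.tabulate (does ∘ P?)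

  ∈-comprehension⁺ : ∀ {v} → P v → v Sub.∈ comprehension
  ∈-comprehension⁺ {v} pv = Vecₚ.lookup⇒[]= v _ (trans (Vecₚ.lookup∘tabulate _ v) (dec-true (P? v) pv))

  ∈-comprehension⁻ : ∀ {v} → v Sub.∈ comprehension → P v
  ∈-comprehension⁻ {v} v∈ with P? v | trans (≡.sym (Vecₚ.lookup∘tabulate (does ∘ P?) v)) (Vecₚ.[]=⇒lookup v∈)
  ... | yes pv | _ = pv

-- The branching of every recursion over the three children: one child already yields the exit `A`,
-- or all three yield the data `B` to be combined.
any⊎all₃ : ∀ {A B : Fin 3 → Set} → (∀ j → A j ⊎ B j) → ∃ A ⊎ (∀ j → B j)
any⊎all₃ f with f 0F | f 1F | f 2F
... | inj₁ a | _      | _      = inj₁ (_ , a)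
... | inj₂ _ | inj₁ a | _      = inj₁ (_ , a)
... | inj₂ _ | inj₂ _ | inj₁ a = inj₁ (_ , a)
... | inj₂ p | inj₂ q | inj₂ r = inj₂ λ { 0F → p ; 1F → q ; 2F → r }

-- Serves to pick the child `q` whose cutting time is the median.
sort₃ : (f : Fin 3 → ℕ) → ∃ λ p → ∃ λ q → ∃ λ r →
        p ≢ q × p ≢ r × q ≢ r × f p ≤ f q × f q ≤ f r
sort₃ f with ≤-total (f 0F) (f 1F) | ≤-total (f 1F) (f 2F) | ≤-total (f 0F) (f 2F)
... | inj₁ 0≤1 | inj₁ 1≤2 | _        = 0F , 1F , 2F , (λ ()) , (λ ()) , (λ ()) , 0≤1 , 1≤2
... | inj₁ 0≤1 | inj₂ 2≤1 | inj₁ 0≤2 = 0F , 2F , 1F , (λ ()) , (λ ()) , (λ ()) , 0≤2 , 2≤1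
... | inj₁ 0≤1 | inj₂ 2≤1 | inj₂ 2≤0 = 2F , 0F , 1F , (λ ()) , (λ ()) , (λ ()) , 2≤0 , 0≤1
... | inj₂ 1≤0 | inj₁ 1≤2 | inj₁ 0≤2 = 1F , 0F , 2F , (λ ()) , (λ ()) , (λ ()) , 1≤0 , 0≤2
... | inj₂ 1≤0 | inj₁ 1≤2 | inj₂ 2≤0 = 1F , 2F , 0F , (λ ()) , (λ ()) , (λ ()) , 1≤2 , 2≤0
... | inj₂ 1≤0 | inj₂ 2≤1 | _        = 2F , 1F , 0F , (λ ()) , (λ ()) , (λ ()) , 2≤1 , 1≤0

others₃ : (e : Fin 3) → ∃ λ q → ∃ λ r → e ≢ q × e ≢ r × q ≢ r × (∀ j → j ≡ e ⊎ j ≡ q ⊎ j ≡ r)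
others₃ 0F = 1F , 2F , (λ ()) , (λ ()) , (λ ()) , λ { 0F → inj₁ refl ; 1F → inj₂ (inj₁ refl) ; 2F → inj₂ (inj₂ refl) }
others₃ 1F = 0F , 2F , (λ ()) , (λ ()) , (λ ()) , λ { 0F → inj₂ (inj₁ refl) ; 1F → inj₁ refl ; 2F → inj₂ (inj₂ refl) }
others₃ 2F = 0F , 1F , (λ ()) , (λ ()) , (λ ()) , λ { 0F → inj₂ (inj₁ refl) ; 1F → inj₂ (inj₂ refl) ; 2F → inj₁ refl }

-- The complete ternary tree, in preorder

-- Counts the nodes other than the root, in accordance with `Tree`, whose nodes are `Fin (suc t)`;
-- the whole tree has `suc (order h)` nodes.
order : ℕ → ℕ
order zero    = 0
order (suc h) = 3 * suc (order h)

-- The j-th child subtree occupies the j-th block of the non-root nodes.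
below : ∀ {m} → Fin 3 → Fin (suc m) → Fin (suc (3 * suc m))
below j x = suc (combine j x)

parentBelow : ∀ {m} → (Fin m → Fin (suc m)) → Fin 3 × Fin (suc m) → Fin (suc (3 * suc m))
parentBelow par (j , zero)  = zero
parentBelow par (j , suc x) = below j (par x)

parentOf : ∀ h → Fin (order h) → Fin (suc (order h))
parentOf (suc h) i = parentBelow (parentOf h) (remQuot {3} (suc (order h)) i)

parentOf-combine : ∀ h (j : Fin 3) (x : Fin (suc (order h))) →
                   parentOf (suc h) (combine j x) ≡ parentBelow (parentOf h) (j , x)
parentOf-combine h j x = cong (parentBelow (parentOf h)) (remQuot-combine j x)

parentOf-≤ : ∀ h i → toℕ (parentOf h i) ≤ toℕ i
parentOf-≤ (suc h) i = 
  ≤-trans (combined (remQuot {3} (suc (order h)) i)) (≤-reflexive (cong toℕ (combine-remQuot {3} (suc (order h)) i)))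
  where
  open ≤-Reasoning
  combined : ∀ ((j , x) : Fin 3 × Fin (suc (order h))) →
             toℕ (parentBelow (parentOf h) (j , x)) ≤ toℕ (combine j x)
  combined (j , zero)  = z≤n
  combined (j , suc x) = begin
    suc (toℕ (combine j (parentOf h x)))              ≡⟨ cong suc (toℕ-combine j (parentOf h x)) ⟩
    suc (suc (order h) * toℕ j + toℕ (parentOf h x))  ≤⟨ s≤s (+-monoʳ-≤ (suc (order h) * toℕ j) (parentOf-≤ h x)) ⟩
    suc (suc (order h) * toℕ j + toℕ x)               ≡⟨ +-suc (suc (order h) * toℕ j) (toℕ x) ⟨
    suc (order h) * toℕ j + suc (toℕ x)               ≡⟨ toℕ-combine j (suc x) ⟨
    toℕ (combine j (suc x))                           ∎

ternary : ℕ → Tree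
ternary h = record { t = order h ; parent = parentOf h ; parent< = parentOf-≤ h }

TreeAdj-sym : ∀ {T x y} → TreeAdj T x y → TreeAdj T y x
TreeAdj-sym (up i)   = down i
TreeAdj-sym (down i) = up i

root-below : ∀ h j → TreeAdj (ternary (suc h)) zero (below j zero)
root-below h j = subst (λ x → TreeAdj (ternary (suc h)) x (below j zero)) (parentOf-combine h j zero) (down (combine j zero))

below-adj : ∀ h j {x y} → TreeAdj (ternary h) x y → TreeAdj (ternary (suc h)) (below j x) (below j y)
below-adj h j (up i)   = subst (TreeAdj (ternary (suc h)) (below j (suc i))) (parentOf-combine h j (suc i)) (up (combine j (suc i)))
below-adj h j (down i) = TreeAdj-sym (below-adj h j (up i))

below-injective : ∀ {m} {i j} {x y : Fin (suc m)} → below i x ≡ below j y → i ≡ j × x ≡ y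
below-injective {i = i} {j} {x} {y} eq = combine-injective i x j y (Finₚ.suc-injective eq)

-- A view that recovers the root or the block and position from a bare index, so that nodes can be
-- split by pattern matching.
data RootOrBelow {m} : Fin (suc (3 * suc m)) → Set where
  isRoot  : RootOrBelow zero
  isBelow : ∀ j x → RootOrBelow (below j x)

rootOrBelow : ∀ {m} (x : Fin (suc (3 * suc m))) → RootOrBelow x
rootOrBelow zero    = isRoot
rootOrBelow {m} (suc i) = subst (RootOrBelow ∘ suc) (combine-remQuot {3} (suc m) i)
  (let j , x = remQuot {3} (suc m) i in isBelow j x)

-- The blow-up of the ternary tree

module Blowup (r H : ℕ) where

  Node : Set
  Node = Fin (suc (order H))

  Vertex : Set
  Vertex = Fin (suc (order H) * r)

  at : Vertex → Node
  at u = proj₁ (remQuot {suc (order H)} r u)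

  -- Equality is included so that the vertices of one node form a clique.
  Near : Node → Node → Set
  Near x y = x ≡ y ⊎ TreeAdj (ternary H) x y

  Near-sym : ∀ {x y} → Near x y → Near y x
  Near-sym (inj₁ eq) = inj₁ (≡.sym eq)
  Near-sym (inj₂ a)  = inj₂ (TreeAdj-sym a)

  blowup : Graph
  blowup = record
    { n      = suc (order H) * r
    ; Adj    = λ u v → u ≢ v × Near (at u) (at v)
    ; sym    = λ (u≢v , a) → u≢v ∘ ≡.sym , Near-sym a
    ; irrefl = λ (u≢u , _) → u≢u refl
    }

  vertices : Node → List Vertex
  vertices x = tabulate (combine x)

  length-vertices : ∀ x → length (vertices x) ≡ r
  length-vertices x = length-tabulate (combine x)

  vertices-unique : ∀ x → Unique (vertices x)
  vertices-unique x = Uniqueₚ.tabulate⁺ (λ {i} {j} eq → proj₂ (combine-injective x i x j eq))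

  at-combine : ∀ x i → at (combine x i) ≡ x
  at-combine x i = cong proj₁ (remQuot-combine x i)

  ∈-vertices⁻ : ∀ {x u} → u ∈ vertices x → at u ≡ x
  ∈-vertices⁻ {x} u∈ with i , refl ← ∈-tabulate⁻ u∈ = at-combine x i

  ∈-vertices⁺ : ∀ {x u} → at u ≡ x → u ∈ vertices x
  ∈-vertices⁺ {u = u} refl = subst (_∈ vertices (at u)) (combine-remQuot {suc (order H)} r u) (∈-tabulate⁺ (proj₂ (remQuot {suc (order H)} r u)))

  -- The tree decomposition

  bagNodes : Node → List Node
  bagNodes zero    = zero ∷ []
  bagNodes (suc i) = suc i ∷ parentOf H i ∷ []

  self∈bagNodes : ∀ x → x ∈ bagNodes x
  self∈bagNodes zero    = here refl
  self∈bagNodes (suc i) = here refl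

  inBag? : ∀ x u → Dec (at u ∈ bagNodes x)
  inBag? x u = mem? Fin._≟_ (at u) (bagNodes x)

  bagOf : Node → Subset (suc (order H) * r)
  bagOf x = comprehension (inBag? x)

  length-concatMap-vertices : ∀ xs → length (concatMap vertices xs) ≡ length xs * r
  length-concatMap-vertices []       = refl
  length-concatMap-vertices (x ∷ xs) =
    trans (length-++ (vertices x)) (cong₂ _+_ (length-vertices x) (length-concatMap-vertices xs))

  ∈-concatMap-vertices : ∀ {xs u} → at u ∈ xs → u ∈ concatMap vertices xs
  ∈-concatMap-vertices = ∈-concatMap⁺ vertices ∘ Any.map ∈-vertices⁺

  length-bagNodes : ∀ x → length (bagNodes x) ≤ 2
  length-bagNodes zero    = s≤s z≤n
  length-bagNodes (suc i) = ≤-refl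

  ∣bagOf∣≤2*r : ∀ x → ∣ bagOf x ∣ ≤ 2 * r
  ∣bagOf∣≤2*r x = begin
    ∣ bagOf x ∣                                ≤⟨ ∣p∣≤length (bagOf x) _ (∈-concatMap-vertices ∘ ∈-comprehension⁻ (inBag? x)) ⟩
    length (concatMap vertices (bagNodes x))  ≡⟨ length-concatMap-vertices (bagNodes x) ⟩
    length (bagNodes x) * r                   ≤⟨ *-monoˡ-≤ r (length-bagNodes x) ⟩
    2 * r                                     ∎
    where open ≤-Reasoning

  decomposition : ∀ {k} → 2 * r ≤ suc k → TreewidthAtMost blowup k
  decomposition 2r≤ = record
    { tree      = ternary H
    ; bag       = bagOf
    ; bagSize   = λ x → ≤-trans (∣bagOf∣≤2*r x) 2r≤
    ; covVertex = λ v → at v , own v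
    ; covEdge   = λ u v (_ , a) → edge u v a
    -- The bags containing `v` belong to its own node and the children of that node. They form a
    -- star, so any two are joined through the centre `at v`.
    ; connected = λ v x y v∈x v∈y → toOwn v x v∈x ◅◅ fromOwn v y v∈y
    }
    where
    own : ∀ v → v Sub.∈ bagOf (at v)
    own v = ∈-comprehension⁺ (inBag? (at v)) (self∈bagNodes (at v))
    edge′ : ∀ u v {x y} → at u ≡ x → at v ≡ y → TreeAdj (ternary H) x y → ∃ λ z → u Sub.∈ bagOf z × v Sub.∈ bagOf z
    edge′ u v p q (up i)   = suc i , ∈-comprehension⁺ (inBag? (suc i)) (here p) , ∈-comprehension⁺ (inBag? (suc i)) (there (here q))
    edge′ u v p q (down i) = suc i , ∈-comprehension⁺ (inBag? (suc i)) (there (here p)) , ∈-comprehension⁺ (inBag? (suc i)) (here q)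
    edge : ∀ u v → Near (at u) (at v) → ∃ λ z → u Sub.∈ bagOf z × v Sub.∈ bagOf z
    edge u v (inj₁ eq) = at u , own u , subst (λ z → v Sub.∈ bagOf z) (≡.sym eq) (own v)
    edge u v (inj₂ a)  = edge′ u v refl refl a
    nearOwn : ∀ v x → v Sub.∈ bagOf x → x ≡ at v ⊎ TreeAdj (ternary H) x (at v)
    nearOwn v x v∈ = go x (∈-comprehension⁻ (inBag? x) v∈)
      where
      go : ∀ x → at v ∈ bagNodes x → x ≡ at v ⊎ TreeAdj (ternary H) x (at v)
      go zero    (here eq)         = inj₁ (≡.sym eq)
      go (suc i) (here eq)         = inj₁ (≡.sym eq)
      go (suc i) (there (here eq)) = inj₂ (subst (TreeAdj (ternary H) (suc i)) (≡.sym eq) (up i))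
    toOwn : ∀ v x → v Sub.∈ bagOf x → Star (AdjIn (ternary H) (λ z → v Sub.∈ bagOf z)) x (at v)
    toOwn v x v∈ with nearOwn v x v∈
    ... | inj₁ refl = ε
    ... | inj₂ a    = (a , v∈ , own v) ◅ ε
    fromOwn : ∀ v x → v Sub.∈ bagOf x → Star (AdjIn (ternary H) (λ z → v Sub.∈ bagOf z)) (at v) x
    fromOwn v x v∈ with nearOwn v x v∈
    ... | inj₁ refl = ε
    ... | inj₂ a    = (TreeAdj-sym a , own v , v∈) ◅ ε

  -- Copies of smaller ternary trees

  -- Subtrees are given as copies of the standard tree inside the fixed tree of height `H`; passing
  -- to a child is composition with `below j`, which allows induction on `h`.
  record Embedding (h : ℕ) : Set where
    field
      φ         : Fin (suc (order h)) → Node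
      injective : ∀ {x y} → φ x ≡ φ y → x ≡ y
      preserves : ∀ {x y} → TreeAdj (ternary h) x y → TreeAdj (ternary H) (φ x) (φ y)

    top : Node
    top = φ zero

    Top In : Vertex → Set
    Top u = at u ≡ top
    In u  = ∃ λ x → at u ≡ φ x

    Top⊆In : ∀ {u} → Top u → In u
    Top⊆In eq = zero , eq

  open Embedding

  whole : Embedding H
  whole = record { φ = id ; injective = id ; preserves = id }

  child : ∀ {h} → Embedding (suc h) → Fin 3 → Embedding h
  child σ j = record
    { φ         = φ σ ∘ below j
    ; injective = λ eq → proj₂ (below-injective {i = j} {j} (injective σ eq))
    ; preserves = preserves σ ∘ below-adj _ j
    }

  child⊆ : ∀ {h} (σ : Embedding (suc h)) j {u} → In (child σ j) u → In σ u
  child⊆ σ j (x , eq) = below j x , eq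

  In⇒Top⊎child : ∀ {h} (σ : Embedding (suc h)) {u} → In σ u → Top σ u ⊎ ∃ λ j → In (child σ j) u
  In⇒Top⊎child σ (x , eq) with rootOrBelow x
  ... | isRoot      = inj₁ eq
  ... | isBelow j y = inj₂ (j , y , eq)

  In₀⇒Top : (σ : Embedding 0) → ∀ {u} → In σ u → Top σ u
  In₀⇒Top σ (zero , eq) = eq

  Top∩child : ∀ {h} (σ : Embedding (suc h)) j {u} → Top σ u → In (child σ j) u → ⊥
  Top∩child σ j p (x , q) with () ← injective σ (trans (≡.sym p) q)

  child∩child : ∀ {h} (σ : Embedding (suc h)) i j {u} → i ≢ j → In (child σ i) u → In (child σ j) u → ⊥
  child∩child σ i j i≢j (x , p) (y , q) = i≢j (proj₁ (below-injective (injective σ (trans (≡.sym p) q))))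

  top-near : ∀ {h} (σ : Embedding (suc h)) j → Near (top σ) (top (child σ j))
  top-near σ j = inj₂ (preserves σ (root-below _ j))

  -- Bichromatic matchings

  -- Ends are indexed by their colour, so that arguments symmetric in the two colours are carried
  -- out once for a generic `b`.
  end : Bool → Vertex × Vertex → Vertex
  end true  = proj₁
  end false = proj₂

  Within : Node → (Vertex → Set) → Set
  Within x P = ∀ {u} → at u ≡ x → P u

  infixr 6 _⊍_
  _⊍_ : (Vertex → Set) → (Vertex → Set) → Vertex → Set
  (P ⊍ Q) u = P u ⊎ Q u

  module _ (χ : Vertex → Bool) where

    record Matching (P : Vertex → Set) : Set where
      field
        edges  : List (Vertex × Vertex)
        near   : All (λ e → Near (at (end true e)) (at (end false e))) edges
        ends   : ∀ b → All (λ e → χ (end b e) ≡ b × P (end b e)) edges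
        unique : ∀ b → Unique (map (end b) edges)

      size : ℕ
      size = length edges

      endList : Bool → List Vertex
      endList b = map (end b) edges

      ∈-endList⁻ : ∀ b {u} → u ∈ endList b → χ u ≡ b × P u
      ∈-endList⁻ b u∈ with e , e∈ , refl ← ∈-map⁻ (end b) u∈ = All.lookup (ends b) e∈

      length-endList : ∀ b → length (endList b) ≡ size
      length-endList b = length-map (end b) edges

  open Matching

  module _ {χ : Vertex → Bool} where

    private variable P Q : Vertex → Set

    ∅ : Matching χ P
    ∅ = record { edges = [] ; near = [] ; ends = λ _ → [] ; unique = λ _ → [] }

    widen : (∀ {u} → P u → Q u) → Matching χ P → Matching χ Q
    widen P⊆Q M = record
      { edges = edges M ; near = near M ; unique = unique M
      ; ends  = λ b → All.map (λ (c , p) → c , P⊆Q p) (ends M b) }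

    union : (∀ {u} → P u → Q u → ⊥) → Matching χ P → Matching χ Q → Matching χ (P ⊍ Q)
    union disjoint M N = record
      { edges  = edges M ++ edges N
      ; near   = Allₚ.++⁺ (near M) (near N)
      ; ends   = λ b → Allₚ.++⁺ (All.map (λ (c , p) → c , inj₁ p) (ends M b)) (All.map (λ (c , q) → c , inj₂ q) (ends N b))
      ; unique = λ b → subst Unique (≡.sym (map-++ (end b) (edges M) (edges N)))
          (Uniqueₚ.++⁺ (unique M b) (unique N b)
            (λ (u∈M , u∈N) → disjoint (proj₂ (∈-endList⁻ M b u∈M)) (proj₂ (∈-endList⁻ N b u∈N))))
      }

    size-union : (disjoint : ∀ {u} → P u → Q u → ⊥) (M : Matching χ P) (N : Matching χ Q) →
                 size (union disjoint M N) ≡ size M + size N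
    size-union _ M N = length-++ (edges M)

    module _ (M : Matching χ P) (N : Matching χ Q) (b : Bool) where

      private
        split = map-++ (end b) (edges M) (edges N)

      ∈-ends-++ˡ : ∀ {u} → u ∈ endList M b → u ∈ map (end b) (edges M ++ edges N)
      ∈-ends-++ˡ {u} u∈ = subst (u ∈_) (≡.sym split) (∈-++⁺ˡ u∈)

      ∈-ends-++ʳ : ∀ {u} → u ∈ endList N b → u ∈ map (end b) (edges M ++ edges N)
      ∈-ends-++ʳ {u} u∈ = subst (u ∈_) (≡.sym split) (∈-++⁺ʳ (endList M b) u∈)

    Coloured : Bool → Node → List Vertex → Set
    Coloured b x = All (λ u → at u ≡ x × χ u ≡ b)

    -- Vertices of near nodes with different colours are always adjacent, so any two lists of equal
    -- length can be paired entry by entry. The exact end lists are returned because later arguments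
    -- need to know which vertices are covered.
    zipMatching : ∀ {x y us vs} → Near x y → Coloured true x us → Coloured false y vs →
                  Unique us → Unique vs → length us ≡ length vs → Within x P → Within y P →
                  Σ (Matching χ P) λ M → endList M true ≡ us × endList M false ≡ vs
    zipMatching {us = []} {[]} _ _ _ _ _ _ _ _ = ∅ , refl , refl
    zipMatching {P = P} {us = u ∷ us} {v ∷ vs} xy ((atu , χu) ∷ cu) ((atv , χv) ∷ cv) (u∉ ∷ uu) (v∉ ∷ uv) eq inx iny
      with M , refl , refl ← zipMatching {P = P} xy cu cv uu uv (suc-injective eq) inx iny = record
        { edges  = (u , v) ∷ edges M
        ; near   = ≡.subst₂ Near (≡.sym atu) (≡.sym atv) xy ∷ near M
        ; ends   = λ { true → (χu , inx atu) ∷ ends M true ; false → (χv , iny atv) ∷ ends M false }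
        ; unique = λ { true → u∉ ∷ unique M true ; false → v∉ ∷ unique M false }
        } , refl , refl

    biclique : ∀ b {x y us vs} → Near x y → Coloured b x us → Coloured (not b) y vs →
               Unique us → Unique vs → length us ≡ length vs → Within x P → Within y P →
               Σ (Matching χ P) λ M → endList M b ≡ us × endList M (not b) ≡ vs
    biclique true  xy cu cv uu uv eq inx iny = zipMatching xy cu cv uu uv eq inx iny
    biclique false xy cu cv uu uv eq inx iny
      with M , p , q ← zipMatching (Near-sym xy) cv cu uv uu (≡.sym eq) iny inx = M , q , p

    sized : ∀ {s b us} (M : Matching χ P) → endList M b ≡ us → length us ≡ s → size M ≡ s
    sized {b = b} M refl eq = trans (≡.sym (length-endList M b)) eq

    length≤size : ∀ {us b} (M : Matching χ P) → Unique us → (∀ {u} → u ∈ us → u ∈ endList M b) → length us ≤ size M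
    length≤size {us = us} {b = b} M uu sub = subst (length us ≤_) (length-endList M b) (Unique-⊆⇒length≤ uu sub)

  -- Majority colours

  module _ {s : ℕ} (r≡s+s : r ≡ s + s) where

    module _ (χ : Vertex → Bool) where

      class : Bool → Node → List Vertex
      class b x = filter (λ u → χ u Bool.≟ b) (vertices x)

      class-unique : ∀ b x → Unique (class b x)
      class-unique b x = Uniqueₚ.filter⁺ (λ u → χ u Bool.≟ b) (vertices-unique x)

      class-coloured : ∀ b x → Coloured {χ} b x (class b x)
      class-coloured b x = All.tabulate λ u∈ →
        let u∈x , χu = ∈-filter⁻ (λ u → χ u Bool.≟ b) {xs = vertices x} u∈ in ∈-vertices⁻ u∈x , χu

      ∈-class : ∀ {b x u} → at u ≡ x → χ u ≡ b → u ∈ class b x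
      ∈-class {b} atu χu = ∈-filter⁺ (λ u → χ u Bool.≟ b) (∈-vertices⁺ atu) χu

      length-filters : ∀ b us → length (filter (λ u → χ u Bool.≟ b) us) + length (filter (λ u → χ u Bool.≟ not b) us) ≡ length us
      length-filters b [] = refl
      length-filters b (u ∷ us) with χ u | b | length-filters b us
      ... | true  | true  | ih = cong suc ih
      ... | false | false | ih = cong suc ih
      ... | true  | false | ih = trans (+-suc _ _) (cong suc ih)
      ... | false | true  | ih = trans (+-suc _ _) (cong suc ih)

      length-classes : ∀ b x → length (class b x) + length (class (not b) x) ≡ s + s
      length-classes b x = trans (length-filters b (vertices x)) (trans (length-vertices x) r≡s+s)

      majority : ∀ x → ∃ λ b → s ≤ length (class b x) × length (class (not b) x) ≤ s
      majority x with ≤-total s (length (class true x)) | length-classes true x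
      ... | inj₁ s≤c | eq = true , s≤c , +-cancelˡ-≤ s _ _ (≤-trans (+-monoˡ-≤ _ s≤c) (≤-reflexive eq))
      ... | inj₂ c≤s | eq = false , +-cancelˡ-≤ s _ _ (≤-trans (≤-reflexive (≡.sym eq)) (+-monoˡ-≤ _ c≤s)) , c≤s

      Majority : Bool → Node → Set
      Majority b x = s ≤ length (class b x)

      -- Holds when all nodes have the same majority colour b: the minority
      -- of each node can be matched inside that node.
      Dominated : Bool → ∀ {h} → Embedding h → Set
      Dominated b σ = Majority b (top σ) ×
        Σ (Matching χ (In σ)) λ M → ∀ {u} → In σ u → χ u ≡ not b → u ∈ endList M (not b)

      Big : (Vertex → Set) → Set
      Big P = Σ (Matching χ P) λ M → s ≤ size M

      -- The two nodes are completely joined, so s vertices of colour `b` in `x` can be paired with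
      -- s of the other colour in `y`.
      clash : ∀ {P : Vertex → Set} {b x y} → Near x y → Majority b x → Majority (not b) y → Within x P → Within y P → Big P
      clash {b = b} {x} {y} xy mx my inx iny
        with M , eq , _ ← biclique b xy (Allₚ.take⁺ s (class-coloured b x)) (Allₚ.take⁺ s (class-coloured (not b) y))
               (Uniqueₚ.take⁺ s (class-unique b x)) (Uniqueₚ.take⁺ s (class-unique (not b) y))
               (trans (length-take-≤ mx) (≡.sym (length-take-≤ my))) inx iny
        = M , ≤-reflexive (≡.sym (sized {b = b} M eq (length-take-≤ mx)))

      -- The node is a clique and its minority is no larger than its majority, so each minority
      -- vertex gets its own majority partner there.
      matchMinority : ∀ x → ∃ λ b → Majority b x ×
        Σ (Matching χ (λ u → at u ≡ x)) λ M → ∀ {u} → at u ≡ x → χ u ≡ not b → u ∈ endList M (not b)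
      matchMinority x with b , s≤c , c≤s ← majority x
        with M , _ , eq ← biclique b {us = take (length (class (not b) x)) (class b x)} (inj₁ refl)
               (Allₚ.take⁺ (length (class (not b) x)) (class-coloured b x)) (class-coloured (not b) x)
               (Uniqueₚ.take⁺ (length (class (not b) x)) (class-unique b x)) (class-unique (not b) x)
               (length-take-≤ (≤-trans c≤s s≤c)) id id
        = b , s≤c , M , λ {u} atu χu → subst (u ∈_) (≡.sym eq) (∈-class atu χu)

      -- Compares the majorities at the two ends of the edge from the root to child `j`; opposite
      -- ones produce a big matching by `clash`.
      agree : ∀ {h b} (σ : Embedding (suc h)) → Majority b (top σ) → ∀ j →
              Big (In (child σ j)) ⊎ (∃ λ b′ → Dominated b′ (child σ j)) → Big (In σ) ⊎ Dominated b (child σ j)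
      agree σ maj j (inj₁ (M , s≤)) = inj₁ (widen (child⊆ σ j) M , s≤)
      agree {b = b} σ maj j (inj₂ (b′ , dom)) with b Bool.≟ b′
      ... | yes refl = inj₂ dom
      ... | no  b≢b′ = inj₁ (clash {b = b} (top-near σ j) maj
              (subst (λ c → Majority c (top (child σ j))) (¬-not (b≢b′ ∘ ≡.sym)) (proj₁ dom))
              (Top⊆In σ) (child⊆ σ j ∘ Top⊆In (child σ j)))

      -- A tree edge between opposite majorities gives s matching edges at once. Otherwise one
      -- majority colour spreads from the root over the whole copy, and the minority matchings of
      -- the single nodes are disjoint and unite to a matching covering the entire minority.
      dichotomy : ∀ {h} (σ : Embedding h) → Big (In σ) ⊎ ∃ λ b → Dominated b σ
      dichotomy {zero} σ with b , maj , M , cov ← matchMinority (top σ) =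
        inj₂ (b , maj , widen (Top⊆In σ) M , λ u∈ → cov (In₀⇒Top σ u∈))
      dichotomy {suc h} σ with b , maj , M , cov ← matchMinority (top σ)
        with any⊎all₃ (λ j → agree σ maj j (dichotomy (child σ j)))
      ... | inj₁ (_ , big) = inj₁ big
      ... | inj₂ dom = inj₂ (b , maj , widen within whole′ , covered)
        where
        N : ∀ j → Matching χ (In (child σ j))
        N j = proj₁ (proj₂ (dom j))
        N₁₂ = union (child∩child σ 1F 2F λ ()) (N 1F) (N 2F)
        N₀₁₂ = union (λ { p (inj₁ q) → child∩child σ 0F 1F (λ ()) p q ; p (inj₂ q) → child∩child σ 0F 2F (λ ()) p q }) (N 0F) N₁₂
        whole′ = union (λ { p (inj₁ q)        → Top∩child σ 0F p q
                          ; p (inj₂ (inj₁ q)) → Top∩child σ 1F p q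
                          ; p (inj₂ (inj₂ q)) → Top∩child σ 2F p q }) M N₀₁₂
        within : ∀ {u} → (Top σ ⊍ In (child σ 0F) ⊍ In (child σ 1F) ⊍ In (child σ 2F)) u → In σ u
        within (inj₁ p)               = Top⊆In σ p
        within (inj₂ (inj₁ p))        = child⊆ σ 0F p
        within (inj₂ (inj₂ (inj₁ p))) = child⊆ σ 1F p
        within (inj₂ (inj₂ (inj₂ p))) = child⊆ σ 2F p
        covered : ∀ {u} → In σ u → χ u ≡ not b → u ∈ endList whole′ (not b)
        covered u∈ χu with In⇒Top⊎child σ u∈
        ... | inj₁ p = ∈-ends-++ˡ M N₀₁₂ (not b) (cov p χu)
        ... | inj₂ (0F , p) =
          ∈-ends-++ʳ M N₀₁₂ (not b) (∈-ends-++ˡ (N 0F) N₁₂ (not b) (proj₂ (proj₂ (dom 0F)) p χu))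
        ... | inj₂ (1F , p) =
          ∈-ends-++ʳ M N₀₁₂ (not b) (∈-ends-++ʳ (N 0F) N₁₂ (not b)
            (∈-ends-++ˡ (N 1F) (N 2F) (not b) (proj₂ (proj₂ (dom 1F)) p χu)))
        ... | inj₂ (suc 1F , p) =
          ∈-ends-++ʳ M N₀₁₂ (not b) (∈-ends-++ʳ (N 0F) N₁₂ (not b)
            (∈-ends-++ʳ (N 1F) (N 2F) (not b) (proj₂ (proj₂ (dom 2F)) p χu)))

    -- Unless one of the two subtrees already has a big matching, the first is
    -- dominated by true and the second by false, so the root clashes with one.
    connect : ∀ {h} (χ : Vertex → Bool) (σ : Embedding (suc h)) p q → p ≢ q → ∀ {us vs} →
              Unique us → s ≤ length us → (∀ {u} → u ∈ us → χ u ≡ true × In (child σ p) u) →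
              Unique vs → s ≤ length vs → (∀ {v} → v ∈ vs → χ v ≡ false × In (child σ q) v) →
              Big χ (Top σ ⊍ In (child σ p) ⊍ In (child σ q))
    connect χ σ p q p≢q {us} {vs} uu s≤us inus uv s≤vs invs
      with dichotomy χ (child σ p) | dichotomy χ (child σ q)
    ... | inj₁ (M , s≤) | _ = widen (inj₂ ∘ inj₁) M , s≤
    -- Here true is the minority colour, so `M` covers every true vertex of this child, and `us`
    -- provides s of them.
    ... | inj₂ (false , _ , M , cov) | _ = widen (inj₂ ∘ inj₁) M ,
          ≤-trans s≤us (length≤size {us = us} {b = true} M uu (λ u∈ → let χu , inu = inus u∈ in cov inu χu))
    ... | inj₂ (true , _) | inj₁ (M , s≤) = widen (inj₂ ∘ inj₂) M , s≤
    ... | inj₂ (true , _) | inj₂ (true , _ , M , cov) = widen (inj₂ ∘ inj₂) M ,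
          ≤-trans s≤vs (length≤size {us = vs} {b = false} M uv (λ v∈ → let χv , inv = invs v∈ in cov inv χv))
    ... | inj₂ (true , majp , _) | inj₂ (false , majq , _) with majority χ (top σ)
    ... | true  , maj , _ = clash χ {b = true} (top-near σ q) maj majq inj₁ (inj₂ ∘ inj₂ ∘ Top⊆In (child σ q))
    ... | false , maj , _ = clash χ {b = false} (top-near σ p) maj majp inj₁ (inj₂ ∘ inj₁ ∘ Top⊆In (child σ p))

    -- Cutting a full subtree along an ordering

    module _ {L : List Vertex} (L-unique : Unique L) where

      prefix : ℕ → Vertex → Bool
      prefix i u = does (mem? Fin._≟_ u (take i L))

      prefix-true⁻ : ∀ i {u} → prefix i u ≡ true → u ∈ take i L
      prefix-true⁻ i {u} eq with mem? Fin._≟_ u (take i L)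
      ... | yes p = p

      prefix-false⁻ : ∀ i {u} → prefix i u ≡ false → ¬ u ∈ take i L
      prefix-false⁻ i {u} eq with mem? Fin._≟_ u (take i L)
      ... | no ¬p = ¬p

      prefix-true⁺ : ∀ i {u} → u ∈ take i L → prefix i u ≡ true
      prefix-true⁺ i {u} = dec-true (mem? Fin._≟_ u (take i L))

      prefix-false⁺ : ∀ i {u} → ¬ u ∈ take i L → prefix i u ≡ false
      prefix-false⁺ i {u} = dec-false (mem? Fin._≟_ u (take i L))

      -- The prefix is stopped when exactly s of the 2s vertices of the clique at `x` have appeared;
      -- these are paired with s that come later.
      halfNode : ∀ x → (∀ {u} → at u ≡ x → u ∈ L) →
                 ∃ λ i → i ≤ length L × Big (prefix i) (λ u → at u ≡ x)
      halfNode x x⊆L = let i , i≤ , eq = filter-prefix x? L (≤-trans (m≤m+n s s) 2s≤) in i , i≤ , half i eq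
        where
        open ≤-Reasoning
        x? : ∀ u → Dec (at u ≡ x)
        x? u = at u Fin.≟ x
        2s≤ : s + s ≤ length (filter x? L)
        2s≤ = subst (_≤ length (filter x? L)) (trans (length-vertices x) r≡s+s)
          (Unique-⊆⇒length≤ (vertices-unique x) (λ u∈ → let atu = ∈-vertices⁻ u∈ in ∈-filter⁺ x? (x⊆L atu) atu))
        rest : ∀ i → length (filter x? (take i L)) ≡ s → s ≤ length (filter x? (drop i L))
        rest i eq = +-cancelˡ-≤ s _ _ (begin
            s + s                                                          ≤⟨ 2s≤ ⟩
            length (filter x? L)                                           ≡⟨ cong (length ∘ filter x?) (take++drop≡id i L) ⟨
            length (filter x? (take i L ++ drop i L))                      ≡⟨ cong length (filter-++ x? (take i L) (drop i L)) ⟩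
            length (filter x? (take i L) ++ filter x? (drop i L))          ≡⟨ length-++ (filter x? (take i L)) ⟩
            length (filter x? (take i L)) + length (filter x? (drop i L))  ≡⟨ cong (_+ length (filter x? (drop i L))) eq ⟩
            s + length (filter x? (drop i L))  ∎)
        half : ∀ i → length (filter x? (take i L)) ≡ s → Big (prefix i) (λ u → at u ≡ x)
        half i eq
          with M , p , _ ← zipMatching {χ = prefix i} {P = λ u → at u ≡ x} {us = filter x? (take i L)} {take s (filter x? (drop i L))}
            (inj₁ refl)
            (All.tabulate λ u∈ → let u∈i , atu = ∈-filter⁻ x? {xs = take i L} u∈ in atu , prefix-true⁺ i u∈i)
            (Allₚ.take⁺ s (All.tabulate λ u∈ → let u∈i , atu = ∈-filter⁻ x? {xs = drop i L} u∈ in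
              atu , prefix-false⁺ i (λ u∈t → take-drop-disjoint i L-unique u∈t u∈i)))
            (Uniqueₚ.filter⁺ x? (Uniqueₚ.take⁺ i L-unique))
            (Uniqueₚ.take⁺ s (Uniqueₚ.filter⁺ x? (Uniqueₚ.drop⁺ i L-unique)))
            (trans eq (≡.sym (length-take-≤ (rest i eq)))) id id
          = M , ≤-reflexive (≡.sym (sized {b = true} M p eq))

      fullWidth : ∀ {h} (σ : Embedding h) → (∀ {u} → In σ u → u ∈ L) →
                  ∃ λ i → i ≤ length L × Σ (Matching (prefix i) (In σ)) λ M → s * suc h ≤ size M
      fullWidth {zero} σ σ⊆L with i , i≤ , M , s≤ ← halfNode (top σ) (σ⊆L ∘ Top⊆In σ) =
        i , i≤ , widen (Top⊆In σ) M , ≤-trans (≤-reflexive (*-identityʳ s)) s≤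
      fullWidth {suc h} σ σ⊆L
        with p , q , r , p≢q , p≢r , q≢r , ip≤iq , iq≤ir ← sort₃ (λ j → proj₁ (fullWidth (child σ j) (σ⊆L ∘ child⊆ σ j)))
        -- The cut is made at the median time `iq`: child `p` was cut no later and child `r` no
        -- earlier.
        with ip , _ , Mp , p≤ ← fullWidth (child σ p) (σ⊆L ∘ child⊆ σ p)
           | iq , iq≤ , Mq , q≤ ← fullWidth (child σ q) (σ⊆L ∘ child⊆ σ q)
           | ir , _ , Mr , r≤ ← fullWidth (child σ r) (σ⊆L ∘ child⊆ σ r)
        -- The true ends of `Mp` remain inside the longer prefix `iq`, and the false ends of `Mr`
        -- remain outside the shorter one. Each matching has at least s edges, so the two outer
        -- children supply the s vertices of each colour that `connect` asks for.
        with N , s≤N ← connect (prefix iq) σ p r p≢r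
               (unique Mp true)  (≤-trans (≤-trans (m≤m*n s (suc h)) p≤) (≤-reflexive (≡.sym (length-endList Mp true))))
               (λ u∈ → let χu , inu = ∈-endList⁻ Mp true u∈ in
                 prefix-true⁺ iq (take-mono-∈ ip≤iq L (prefix-true⁻ ip χu)) , inu)
               (unique Mr false) (≤-trans (≤-trans (m≤m*n s (suc h)) r≤) (≤-reflexive (≡.sym (length-endList Mr false))))
               (λ u∈ → let χu , inu = ∈-endList⁻ Mr false u∈ in
                 prefix-false⁺ iq (prefix-false⁻ ir χu ∘ take-mono-∈ iq≤ir L) , inu)
        = iq , iq≤ , widen within (union disjoint Mq N) , (begin
            s * suc (suc h)            ≡⟨ *-suc s (suc h) ⟩
            s + s * suc h              ≡⟨ +-comm s (s * suc h) ⟩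
            s * suc h + s              ≤⟨ +-mono-≤ q≤ s≤N ⟩
            size Mq + size N           ≡⟨ size-union disjoint Mq N ⟨
            size (union disjoint Mq N) ∎)
        where
        open ≤-Reasoning
        disjoint : ∀ {u} → In (child σ q) u → (Top σ ⊍ In (child σ p) ⊍ In (child σ r)) u → ⊥
        disjoint a (inj₁ b)        = Top∩child σ q b a
        disjoint a (inj₂ (inj₁ b)) = child∩child σ p q p≢q b a
        disjoint a (inj₂ (inj₂ b)) = child∩child σ q r q≢r a b
        within : ∀ {u} → (In (child σ q) ⊍ Top σ ⊍ In (child σ p) ⊍ In (child σ r)) u → In σ u
        within (inj₁ a)               = child⊆ σ q a
        within (inj₂ (inj₁ a))        = Top⊆In σ a
        within (inj₂ (inj₂ (inj₁ a))) = child⊆ σ p a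
        within (inj₂ (inj₂ (inj₂ a))) = child⊆ σ r a

  -- Monochromatic copies and few bichromatic edges

  module _ (χ : Vertex → Bool) (c₀ : Fin r) where

    Mono : Bool → ∀ {h} → Embedding h → Set
    Mono b σ = ∀ {u} → In σ u → χ u ≡ b

    bichromaticEdge : ∀ b {P u v} → Near (at u) (at v) → χ u ≡ b → χ v ≡ not b → P u → P v →
                      Σ (Matching χ P) λ M → size M ≡ 1
    bichromaticEdge true  {u = u} {v} uv χu χv pu pv = record
      { edges  = (u , v) ∷ [] ; near = uv ∷ []
      ; ends   = λ { true → (χu , pu) ∷ [] ; false → (χv , pv) ∷ [] }
      ; unique = λ { true → [] ∷ [] ; false → [] ∷ [] } } , refl
    bichromaticEdge false uv χu χv pu pv = bichromaticEdge true (Near-sym uv) χv χu pv pu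

    nodeSearch : ∀ x b → (∃ λ u → at u ≡ x × χ u ≡ b) ⊎ (∀ {u} → at u ≡ x → χ u ≡ not b)
    nodeSearch x b with Any.any? (λ u → χ u Bool.≟ b) (vertices x)
    ... | yes found with u , u∈ , χu ← find found = inj₁ (u , ∈-vertices⁻ u∈ , χu)
    ... | no ¬found = inj₂ λ atu → ¬-not (λ χu → ¬found (lose (∈-vertices⁺ atu) χu))

    -- Positive evidence against `P` being monochromatic: a bichromatic edge inside it, packaged as
    -- a matching with one edge.
    NonMono : (Vertex → Set) → Set
    NonMono P = Σ (Matching χ P) λ M → size M ≡ 1

    nodeStatus : ∀ x → (∃ λ b → ∀ {u} → at u ≡ x → χ u ≡ b) ⊎ NonMono (λ u → at u ≡ x)
    nodeStatus x with nodeSearch x true | nodeSearch x false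
    ... | inj₂ allFalse | _ = inj₁ (false , allFalse)
    ... | inj₁ _ | inj₂ allTrue = inj₁ (true , allTrue)
    ... | inj₁ (u , atu , χu) | inj₁ (v , atv , χv) =
      inj₂ (bichromaticEdge true (inj₁ (trans atu (≡.sym atv))) χu χv atu atv)

    -- The index `c₀` guarantees that no node is empty.
    topVertex : ∀ {h} (σ : Embedding h) → ∃ λ u → Top σ u
    topVertex σ = combine (top σ) c₀ , at-combine (top σ) c₀

    near-top-child : ∀ {h} (σ : Embedding (suc h)) j {u v} → Top σ u → Top (child σ j) v → Near (at u) (at v)
    near-top-child σ j p q = ≡.subst₂ Near (≡.sym p) (≡.sym q) (top-near σ j)

    monoAgree : ∀ {h b} (σ : Embedding (suc h)) → (∀ {u} → Top σ u → χ u ≡ b) → ∀ j →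
                (∃ λ b′ → Mono b′ (child σ j)) ⊎ NonMono (In (child σ j)) → NonMono (In σ) ⊎ Mono b (child σ j)
    monoAgree σ mono j (inj₂ (M , eq)) = inj₁ (widen (child⊆ σ j) M , eq)
    monoAgree {b = b} σ mono j (inj₁ (b′ , mono′)) with b Bool.≟ b′
    ... | yes refl = inj₂ mono′
    ... | no b≢b′ = let u , pu = topVertex σ ; v , pv = topVertex (child σ j) ; inv = Top⊆In (child σ j) pv in
      inj₁ (bichromaticEdge b (near-top-child σ j pu pv) (mono pu)
        (trans (mono′ inv) (¬-not (b≢b′ ∘ ≡.sym))) (Top⊆In σ pu) (child⊆ σ j inv))

    -- A copy is connected, so if both colours occur they meet along some edge: within a node, or
    -- between a root and the root of a child.
    status : ∀ {h} (σ : Embedding h) → (∃ λ b → Mono b σ) ⊎ NonMono (In σ)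
    status {zero} σ with nodeStatus (top σ)
    ... | inj₁ (b , mono) = inj₁ (b , λ u∈ → mono (In₀⇒Top σ u∈))
    ... | inj₂ (M , eq)   = inj₂ (widen (Top⊆In σ) M , eq)
    status {suc h} σ with nodeStatus (top σ)
    ... | inj₂ (M , eq)   = inj₂ (widen (Top⊆In σ) M , eq)
    ... | inj₁ (b , mono) with any⊎all₃ (λ j → monoAgree σ mono j (status (child σ j)))
    ... | inj₁ (_ , M) = inj₂ M
    ... | inj₂ monos   = inj₁ (b , λ u∈ → [ mono , (λ (j , p) → monos j p) ] (In⇒Top⊎child σ u∈))

    -- Counting true vertices against bichromatic edges

    module _ (h : ℕ) where

      C : ℕ
      C = suc (order h) * r

      r≤C : r ≤ C
      r≤C = m≤m+n r (order h * r)

      -- The vertices of P coloured true number at most b + 2C·m − a, for the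
      -- size m of some matching inside P.
      Bound : ℕ → ℕ → (Vertex → Set) → Set
      Bound a b P = Σ (Matching χ P) λ M → ∃ λ ys →
        (∀ {u} → P u → χ u ≡ true → u ∈ ys) × length ys + a ≤ b + 2 * C * size M

      private variable P Q : Vertex → Set

      Bound-resp : ∀ {a b} → (∀ {u} → P u → Q u) → (∀ {u} → Q u → P u) → Bound a b P → Bound a b Q
      Bound-resp P⊆Q Q⊆P (M , ys , cov , le) = widen P⊆Q M , ys , cov ∘ Q⊆P , le

      -- Matchings in disjoint sets unite and their sizes add, so the slack `a` and the debt `b` add
      -- as well.
      Bound-⊍ : ∀ {a b a′ b′} → (∀ {u} → P u → Q u → ⊥) → Bound a b P → Bound a′ b′ Q → Bound (a + a′) (b + b′) (P ⊍ Q)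
      Bound-⊍ {a = a} {b} {a′} {b′} disjoint (M , ys , cov , le) (M′ , ys′ , cov′ , le′) =
        union disjoint M M′ , ys ++ ys′ ,
        (λ { (inj₁ p) χu → ∈-++⁺ˡ (cov p χu) ; (inj₂ q) χu → ∈-++⁺ʳ ys (cov′ q χu) }) , (begin
          length (ys ++ ys′) + (a + a′)                       ≡⟨ cong (_+ (a + a′)) (length-++ ys) ⟩
          (length ys + length ys′) + (a + a′)                 ≡⟨ interchange (length ys) (length ys′) a a′ ⟩
          (length ys + a) + (length ys′ + a′)                 ≤⟨ +-mono-≤ le le′ ⟩
          (b + 2 * C * size M) + (b′ + 2 * C * size M′)       ≡⟨ interchange b (2 * C * size M) b′ (2 * C * size M′) ⟩
          (b + b′) + (2 * C * size M + 2 * C * size M′)       ≡⟨ cong (b + b′ +_) (*-distribˡ-+ (2 * C) (size M) (size M′)) ⟨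
          (b + b′) + 2 * C * (size M + size M′)               ≡⟨ cong (λ m → b + b′ + 2 * C * m) (size-union disjoint M M′) ⟨
          (b + b′) + 2 * C * size (union disjoint M M′)       ∎)
        where
        open ≤-Reasoning
        interchange = medial +-commutativeSemigroup

      empty⇒Bound : (∀ {u} → P u → χ u ≡ false) → Bound 0 0 P
      empty⇒Bound none = ∅ , [] , (λ p χu → case trans (≡.sym χu) (none p) of λ ()) , z≤n

      Bound⇒weak : ∀ {a} → Bound a 0 P → Bound 0 0 P
      Bound⇒weak (M , ys , cov , le) = M , ys , cov , ≤-trans (+-monoʳ-≤ (length ys) z≤n) le

      top⇒Bound : ∀ {h′} (σ : Embedding h′) → Bound 0 C (Top σ)
      top⇒Bound σ = ∅ , vertices (top σ) , (λ p _ → ∈-vertices⁺ p) , (begin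
        length (vertices (top σ)) + 0   ≡⟨ +-identityʳ _ ⟩
        length (vertices (top σ))       ≡⟨ length-vertices (top σ) ⟩
        r                               ≤⟨ r≤C ⟩
        C                               ≤⟨ m≤m+n C _ ⟩
        C + 2 * C * 0                   ∎)
        where open ≤-Reasoning

      -- One edge is worth 2C: half pays for the at most C true vertices, and the other half is kept
      -- as slack.
      edge⇒Bound : ∀ {ys} → NonMono P → (∀ {u} → P u → χ u ≡ true → u ∈ ys) → length ys ≤ C → Bound C 0 P
      edge⇒Bound {ys = ys} (M , eq) cov le = M , ys , cov , (begin
        length ys + C    ≤⟨ +-monoˡ-≤ C le ⟩
        C + C            ≡⟨ cong (C +_) (+-identityʳ C) ⟨
        2 * C            ≡⟨ *-identityʳ (2 * C) ⟨
        2 * C * 1        ≡⟨ cong (2 * C *_) eq ⟨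
        2 * C * size M   ∎)
        where open ≤-Reasoning

      -- The root together with child `e` already has slack C, so the other two children need only
      -- pay for themselves.
      extend : ∀ {d} (σ : Embedding (suc d)) e → Bound C 0 (Top σ ⊍ In (child σ e)) →
               (∀ j → Bound 0 0 (In (child σ j))) → Bound C 0 (In σ)
      extend σ e strong weak with q , r , e≢q , e≢r , q≢r , cover ← others₃ e =
        subst (λ a → Bound a 0 (In σ)) (trans (+-identityʳ (C + 0)) (+-identityʳ C))
          (Bound-resp to (λ u∈ → from (In⇒Top⊎child σ u∈))
            (Bound-⊍ (λ { (inj₁ (inj₁ a)) b → Top∩child σ r a b
                        ; (inj₁ (inj₂ a)) b → child∩child σ e r e≢r a b
                        ; (inj₂ a) b        → child∩child σ q r q≢r a b })
              (Bound-⊍ (λ { (inj₁ a) b → Top∩child σ q a b ; (inj₂ a) b → child∩child σ e q e≢q a b })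
                strong (weak q)) (weak r)))
        where
        to : ∀ {u} → (((Top σ ⊍ In (child σ e)) ⊍ In (child σ q)) ⊍ In (child σ r)) u → In σ u
        to (inj₁ (inj₁ (inj₁ a))) = Top⊆In σ a
        to (inj₁ (inj₁ (inj₂ a))) = child⊆ σ e a
        to (inj₁ (inj₂ a))        = child⊆ σ q a
        to (inj₂ a)               = child⊆ σ r a
        from : ∀ {u} → Top σ u ⊎ (∃ λ j → In (child σ j) u) → (((Top σ ⊍ In (child σ e)) ⊍ In (child σ q)) ⊍ In (child σ r)) u
        from (inj₁ a) = inj₁ (inj₁ (inj₁ a))
        from (inj₂ (j , a)) with cover j
        ... | inj₁ refl        = inj₁ (inj₁ (inj₂ a))
        ... | inj₂ (inj₁ refl) = inj₁ (inj₂ a)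
        ... | inj₂ (inj₂ refl) = inj₂ a

      merge : ∀ {d} (σ : Embedding (suc d)) → (∀ j → Bound C 0 (In (child σ j))) → Bound C 0 (In σ)
      merge σ strong with M , ys , cov , le ←
        Bound-⊍ {P = Top σ} (λ { a (inj₁ b) → Top∩child σ 0F a b ; a (inj₂ (inj₁ b)) → Top∩child σ 1F a b ; a (inj₂ (inj₂ b)) → Top∩child σ 2F a b })
          (top⇒Bound σ)
          (Bound-⊍ {P = In (child σ 0F)} (λ { a (inj₁ b) → child∩child σ 0F 1F (λ ()) a b ; a (inj₂ b) → child∩child σ 0F 2F (λ ()) a b })
            (strong 0F) (Bound-⊍ (child∩child σ 1F 2F λ ()) (strong 1F) (strong 2F)))
        -- The children contribute slack 3C against the debt C of the root. Of the 2C left, one C is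
        -- the slack to be returned and the other is given away in the first inequality.
        = Bound-resp to (λ u∈ → from (In⇒Top⊎child σ u∈)) (M , ys , cov , +-cancelˡ-≤ C _ _ (begin
            C + (length ys + C)          ≤⟨ +-monoˡ-≤ (length ys + C) (m≤m+n C C) ⟩
            C + C + (length ys + C)      ≡⟨ +-comm (C + C) (length ys + C) ⟩
            length ys + C + (C + C)      ≡⟨ +-assoc (length ys) C (C + C) ⟩
            length ys + (C + (C + C))    ≤⟨ le ⟩
            C + 0 + 2 * C * size M       ≡⟨ cong (_+ 2 * C * size M) (+-identityʳ C) ⟩
            C + 2 * C * size M           ∎))
        where
        open ≤-Reasoning
        to : ∀ {u} → (Top σ ⊍ In (child σ 0F) ⊍ In (child σ 1F) ⊍ In (child σ 2F)) u → In σ u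
        to (inj₁ a)               = Top⊆In σ a
        to (inj₂ (inj₁ a))        = child⊆ σ 0F a
        to (inj₂ (inj₂ (inj₁ a))) = child⊆ σ 1F a
        to (inj₂ (inj₂ (inj₂ a))) = child⊆ σ 2F a
        from : ∀ {u} → Top σ u ⊎ (∃ λ j → In (child σ j) u) → (Top σ ⊍ In (child σ 0F) ⊍ In (child σ 1F) ⊍ In (child σ 2F)) u
        from (inj₁ a)        = inj₁ a
        from (inj₂ (0F , a)) = inj₂ (inj₁ a)
        from (inj₂ (1F , a)) = inj₂ (inj₂ (inj₁ a))
        from (inj₂ (2F , a)) = inj₂ (inj₂ (inj₂ a))

      Full : Set
      Full = Σ (Embedding h) (Mono true)

      -- A root coloured true somewhere gains an edge into any empty child; if no
      -- child is empty, the slack C of each of the three pays for the root.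
      search : ∀ d (σ : Embedding (d + h)) → Full ⊎ (Mono false σ ⊎ Bound C 0 (In σ))
      search zero σ with status σ
      ... | inj₁ (true , mono)  = inj₁ (σ , mono)
      ... | inj₁ (false , mono) = inj₂ (inj₁ mono)
      -- A copy of height `h` with both colours has only C vertices in all, so its single
      -- bichromatic edge suffices.
      ... | inj₂ M = inj₂ (inj₂ (edge⇒Bound {ys = concatMap vertices (tabulate (φ σ))} M
              (λ {u} (x , eq) _ → ∈-concatMap-vertices (subst (_∈ tabulate (φ σ)) (≡.sym eq) (∈-tabulate⁺ {f = φ σ} x)))
              (≤-reflexive (trans (length-concatMap-vertices (tabulate (φ σ))) (cong (_* r) (length-tabulate (φ σ)))))))
      search (suc d) σ with any⊎all₃ (λ j → search d (child σ j))
      ... | inj₁ (_ , full) = inj₁ full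
      ... | inj₂ results with any⊎all₃ results
      ... | inj₂ strong = inj₂ (inj₂ (merge σ strong))
      ... | inj₁ (e , empty) with nodeSearch (top σ) true
      ... | inj₁ (u , pu , χu) = let v , pv = topVertex (child σ e) ; inv = Top⊆In (child σ e) pv in
        inj₂ (inj₂ (extend σ e
          (edge⇒Bound {ys = vertices (top σ)} (bichromaticEdge true (near-top-child σ e pu pv) χu (empty inv) (inj₁ pu) (inj₂ inv))
            (λ { (inj₁ p) _ → ∈-vertices⁺ p ; (inj₂ q) χq → case trans (≡.sym χq) (empty q) of λ () })
            (≤-trans (≤-reflexive (length-vertices (top σ))) r≤C))
          (λ j → [ empty⇒Bound , Bound⇒weak ] (results j))))
      -- The root now adds no true vertex. Unless every child is empty as well, some child has slack
      -- C, and that slack is inherited.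
      ... | inj₂ topEmpty with any⊎all₃ (λ j → swap (results j))
      ... | inj₂ empties = inj₂ (inj₁ (λ u∈ → [ topEmpty , (λ (j , p) → empties j p) ] (In⇒Top⊎child σ u∈)))
      ... | inj₁ (j , strong) = inj₂ (inj₂ (extend σ j
              (Bound-⊍ (Top∩child σ j) (empty⇒Bound topEmpty) strong)
              (λ i → [ empty⇒Bound , Bound⇒weak ] (results i))))

  -- The matching is truncated because `CrossMatching` fixes the size exactly. Only the colours are
  -- used to place the ends relative to `S`.
  toCrossMatching : ∀ {χ P m S} (M : Matching χ P) → m ≤ size M →
                    (∀ {u} → χ u ≡ true → u ∈ S) → (∀ {u} → χ u ≡ false → ¬ u ∈ S) → CrossMatching blowup S m
  toCrossMatching {χ} {m = m} M m≤ inside outside = record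
    { edges     = take m (edges M)
    ; size      = length-take-≤ m≤
    ; adj       = Allₚ.take⁺ m (All.zipWith (λ (near , (χu , _) , (χv , _)) → differ χu χv , near)
                    (near M , All.zip (ends M true , ends M false)))
    ; inS       = Allₚ.take⁺ m (All.map (inside ∘ proj₁) (ends M true))
    ; outS      = Allₚ.take⁺ m (All.map (outside ∘ proj₁) (ends M false))
    ; distinct₁ = subst Unique (take-map m (edges M)) (Uniqueₚ.take⁺ m (unique M true))
    ; distinct₂ = subst Unique (take-map m (edges M)) (Uniqueₚ.take⁺ m (unique M false))
    }
    where
    differ : ∀ {u v} → χ u ≡ true → χ v ≡ false → u ≢ v
    differ χu χv refl with () ← trans (≡.sym χu) χv

  -- The height is a type index, so the whole tree has to be transported before it can be viewed as
  -- one of height `(H ∸ h) + h`.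
  everywhere : ∀ {h} → h ≡ H → Σ (Embedding h) λ σ → ∀ u → In σ u
  everywhere refl = whole , λ u → at u , refl

-- Arithmetic

2^⌊log₂n⌋≤n : ∀ n .{{_ : NonZero n}} → 2 ^ ⌊log₂ n ⌋ ≤ n
2^⌊log₂n⌋≤n n = <-rec (λ n → 1 ≤ n → 2 ^ ⌊log₂ n ⌋ ≤ n) step n (>-nonZero⁻¹ n)
  where
  open ≤-Reasoning
  step : ∀ n → (∀ {m} → m < n → 1 ≤ m → 2 ^ ⌊log₂ m ⌋ ≤ m) → 1 ≤ n → 2 ^ ⌊log₂ n ⌋ ≤ n
  step 1               _  _ = ≤-refl
  step (suc (suc n)) rec _ = begin
    2 ^ ⌊log₂ (2 + n) ⌋                  ≡⟨ cong (λ l → 2 * 2 ^ l) (⌊log₂⌊n/2⌋⌋≡⌊log₂n⌋∸1 (2 + n)) ⟨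
    2 * 2 ^ ⌊log₂ suc ⌊ n /2⌋ ⌋          ≤⟨ *-monoʳ-≤ 2 (rec (s≤s (s≤s (⌊n/2⌋≤n n))) (s≤s z≤n)) ⟩
    2 * suc ⌊ n /2⌋                      ≡⟨ cong (suc ⌊ n /2⌋ +_) (+-identityʳ (suc ⌊ n /2⌋)) ⟩
    suc ⌊ n /2⌋ + suc ⌊ n /2⌋            ≤⟨ +-monoʳ-≤ (suc ⌊ n /2⌋) (⌊n/2⌋≤⌈n/2⌉ (2 + n)) ⟩
    ⌊ 2 + n /2⌋ + ⌈ 2 + n /2⌉            ≡⟨ ⌊n/2⌋+⌈n/2⌉≡n (2 + n) ⟩
    2 + n                                ∎

1+n≤2^n : ∀ n → suc n ≤ 2 ^ n
1+n≤2^n zero    = ≤-refl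
1+n≤2^n (suc n) = begin
  1 + suc n          ≤⟨ +-mono-≤ (m^n>0 2 n) (1+n≤2^n n) ⟩
  2 ^ n + 2 ^ n      ≡⟨ cong (2 ^ n +_) (+-identityʳ (2 ^ n)) ⟨
  2 ^ suc n          ∎
  where open ≤-Reasoning

-- By induction, since 1 + 3y is at most 4y for y at least 1. A power of 2 is convenient for
-- comparison with the logarithm.
1+order≤4^ : ∀ h → suc (order h) ≤ 4 ^ h
1+order≤4^ zero    = ≤-refl
1+order≤4^ (suc h) = ≤-trans (+-monoˡ-≤ (3 * suc (order h)) (s≤s z≤n)) (*-monoʳ-≤ 4 (1+order≤4^ h))

n≤order : ∀ h → h ≤ order h
n≤order zero    = z≤n
n≤order (suc h) = ≤-trans (s≤s (n≤order h)) (m≤m+n (suc (order h)) _)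

^-swap : ∀ m k h → (m ^ k) ^ h ≡ (m ^ h) ^ k
^-swap m k h = trans (^-*-assoc m k h) (trans (cong (m ^_) (*-comm k h)) (≡.sym (^-*-assoc m h k)))

-- With x = 2^h the hypotheses say (4s)^8 ≤ v, x⁴ ≤ v and v ≤ 4s²x³, which is
-- absurd both for x ≤ 4s² and for x > 4s².
few⇒⊥ : ∀ s h v .{{_ : NonZero s}} → (4 * s) ^ 8 ≤ v → 16 ^ h ≤ v → v ≤ 2 * (4 ^ h * (s + s)) * (s * suc h) → ⊥
few⇒⊥ s h v k⁸≤v 16^h≤v v≤ = case ≤-<-connex x a of λ
  { (inj₁ x≤a) → <-irrefl refl (begin-strict
      v                   ≤⟨ v≤ax³ ⟩
      a * x ^ 3           ≤⟨ *-monoʳ-≤ a (^-monoˡ-≤ 3 x≤a) ⟩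
      -- Here the exponent 8 is needed: a = 4s² lies below k² for k = 4s, so a⁴ lies below k⁸.
      a ^ 4               <⟨ ^-monoˡ-< 4 a<k² ⟩
      ((4 * s) ^ 2) ^ 4   ≡⟨ ^-*-assoc (4 * s) 2 4 ⟩
      (4 * s) ^ 8         ≤⟨ k⁸≤v ⟩
      v                   ∎)
  ; (inj₂ a<x) → <-irrefl refl (begin-strict
      v                   ≤⟨ v≤ax³ ⟩
      a * x ^ 3           <⟨ *-monoˡ-< (x ^ 3) {{m^n≢0 x 3 {{m^n≢0 2 h}}}} a<x ⟩
      x ^ 4               ≡⟨ ^-swap 2 4 h ⟨
      16 ^ h              ≤⟨ 16^h≤v ⟩
      v                   ∎)
  }
  where
  open ≤-Reasoning
  open +-*-Solver
  a = 4 * (s * s)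
  x = 2 ^ h
  a<k² : a < (4 * s) ^ 2
  a<k² = begin-strict
    4 * (s * s)    <⟨ *-monoˡ-< (s * s) {{m*n≢0 s s}} {4} {16} (from-yes (4 <? 16)) ⟩
    16 * (s * s)   ≡⟨ solve 1 (λ s → con 16 :* (s :* s) := (con 4 :* s) :^ 2) refl s ⟩
    (4 * s) ^ 2    ∎
  v≤ax³ : v ≤ a * x ^ 3
  v≤ax³ = begin
    v                                    ≤⟨ v≤ ⟩
    2 * (4 ^ h * (s + s)) * (s * suc h)  ≤⟨ *-monoʳ-≤ (2 * (4 ^ h * (s + s))) (*-monoʳ-≤ s (1+n≤2^n h)) ⟩
    2 * (4 ^ h * (s + s)) * (s * x)      ≡⟨ cong (λ y → 2 * (y * (s + s)) * (s * x)) (^-swap 2 2 h) ⟩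
    2 * (x ^ 2 * (s + s)) * (s * x)      ≡⟨ solve 2 (λ s x → con 2 :* (x :^ 2 :* (s :+ s)) :* (s :* x) := con 4 :* (s :* s) :* x :^ 3) refl s x ⟩
    a * x ^ 3                            ∎

-- The family of blow-ups and its partial matching width

data Family (s : ℕ) : Graph → Set where
  member : ∀ H → Family s (Blowup.blowup (s + s) H)

module _ (s : ℕ) .{{_ : NonZero s}} (H : ℕ) where

  open Blowup (s + s) H
  open Matching

  private
    c₀ : Fin (s + s)
    c₀ = Fin.fromℕ< (≤-trans (>-nonZero⁻¹ s) (m≤m+n s s))

  pmw : ∀ h (V : Subset (n blowup)) → (4 * s) ^ 8 ≤ ∣ V ∣ → 16 ^ h ≤ ∣ V ∣ → PMWAtLeast blowup V (s * suc h)
  pmw h V k⁸≤v 16^h≤v L (L-unique , L⇔V) = go (h ≤? H)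
    where
    open ≤-Reasoning
    χ : Vertex → Bool
    χ = Vec.lookup V
    inL : ∀ {u} → χ u ≡ true → u ∈ L
    inL {u} χu = Equivalence.from (L⇔V u) (Vecₚ.lookup⇒[]= u V χu)
    notInL : ∀ {u} → χ u ≡ false → ¬ u ∈ L
    notInL {u} χu u∈L with () ← trans (≡.sym χu) (Vecₚ.[]=⇒lookup (Equivalence.to (L⇔V u) u∈L))
    tooFew : ∣ V ∣ ≤ 2 * (4 ^ h * (s + s)) * (s * suc h) → ⊥
    tooFew = few⇒⊥ s h ∣ V ∣ k⁸≤v 16^h≤v

    found : Full χ c₀ h ⊎ ((∀ u → χ u ≡ false) ⊎ Bound χ c₀ h (C χ c₀ h) 0 (λ _ → ⊤)) →
            ∃ λ i → i ≤ length L × CrossMatching blowup (take i L) (s * suc h)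
    found (inj₁ (τ , full)) =
      let i , i≤ , M , le = fullWidth {s = s} refl L-unique τ (λ u∈ → inL (full u∈)) in
      i , i≤ , toCrossMatching M le (prefix-true⁻ {s = s} refl L-unique i) (prefix-false⁻ {s = s} refl L-unique i)
    found (inj₂ (inj₁ empty)) = ⊥-elim (tooFew (≤-trans (∣p∣≤length V [] none) z≤n))
      where
      none : ∀ {u} → u Sub.∈ V → u ∈ []
      none {u} u∈V with () ← trans (≡.sym (empty u)) (Vecₚ.[]=⇒lookup u∈V)
    found (inj₂ (inj₂ (M , ys , cov , le))) with s * suc h ≤? size M
    -- The prefix is the entire ordering, so the cut separates V from its complement.
    ... | yes ≤m = length L , ≤-refl , subst (λ S → CrossMatching blowup S (s * suc h)) (≡.sym (take-all (length L) L ≤-refl))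
                     (toCrossMatching M ≤m inL notInL)
    -- With fewer than s(h+1) edges the bound leaves V too small for its assumed size.
    ... | no ≰m = ⊥-elim (tooFew (begin
        ∣ V ∣                                   ≤⟨ ∣p∣≤length V ys (λ u∈V → cov tt (Vecₚ.[]=⇒lookup u∈V)) ⟩
        length ys                              ≤⟨ m≤m+n (length ys) _ ⟩
        length ys + C χ c₀ h                   ≤⟨ le ⟩
        2 * C χ c₀ h * size M                  ≤⟨ *-mono-≤ (*-monoʳ-≤ 2 (*-monoˡ-≤ (s + s) (1+order≤4^ h))) (<⇒≤ (≰⇒> ≰m)) ⟩
        2 * (4 ^ h * (s + s)) * (s * suc h)    ∎))

    go : Dec (h ≤ H) → ∃ λ i → i ≤ length L × CrossMatching blowup (take i L) (s * suc h)
    go (yes h≤H) with σ , all ← everywhere (m∸n+n≡m h≤H) with search χ c₀ h (H ∸ h) σ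
    ... | inj₁ full         = found (inj₁ full)
    ... | inj₂ (inj₁ empty) = found (inj₂ (inj₁ (λ u → empty (all u))))
    ... | inj₂ (inj₂ bound) = found (inj₂ (inj₂ (Bound-resp χ c₀ h (λ _ → tt) (λ {u} _ → all u) bound)))
    -- A tree of height below `h` is too small to contain V at all.
    go (no h≰H) = ⊥-elim (tooFew (begin
        ∣ V ∣                                   ≤⟨ ∣p∣≤n V ⟩
        suc (order H) * (s + s)                ≤⟨ *-monoˡ-≤ (s + s) (≤-trans (1+order≤4^ H) (^-monoʳ-≤ 4 (<⇒≤ (≰⇒> h≰H)))) ⟩
        4 ^ h * (s + s)                        ≤⟨ m≤m+n _ _ ⟩
        2 * (4 ^ h * (s + s))                  ≤⟨ m≤m*n _ (s * suc h) {{m*n≢0 s (suc h)}} ⟩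
        2 * (4 ^ h * (s + s)) * (s * suc h)    ∎))

  width : ∀ (V : Subset (n blowup)) → (4 * s) ^ 8 ≤ ∣ V ∣ →
          ∃ λ w → 4 * s * ⌊log₂ ∣ V ∣ ⌋ ≤ 16 * w × PMWAtLeast blowup V w
  -- With l the floor of the logarithm and h = ⌊l/4⌋, l is at most 4(h+1), which gives the factor 16
  -- for k = 4s; also 16^h = 2^(4h) is at most 2^l, hence at most |V|.
  width V k⁸≤v = s * suc h , (begin
      4 * s * l              ≤⟨ *-monoʳ-≤ (4 * s) (begin
        l                      ≡⟨ m≡m%n+[m/n]*n l 4 ⟩
        l % 4 + h * 4          ≤⟨ +-monoˡ-≤ (h * 4) (m%n≤n l 4) ⟩
        suc h * 4              ∎) ⟩
      4 * s * (suc h * 4)    ≡⟨ solve 2 (λ s h → con 4 :* s :* ((con 1 :+ h) :* con 4) := con 16 :* (s :* (con 1 :+ h))) refl s h ⟩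
      16 * (s * suc h)       ∎) , pmw h V k⁸≤v (begin
      16 ^ h                 ≡⟨ ^-*-assoc 2 4 h ⟩
      2 ^ (4 * h)            ≡⟨ cong (2 ^_) (*-comm 4 h) ⟩
      2 ^ (h * 4)            ≤⟨ ^-monoʳ-≤ 2 (m/n*n≤m l 4) ⟩
      2 ^ l                  ≤⟨ 2^⌊log₂n⌋≤n ∣ V ∣ {{>-nonZero (≤-trans (m^n>0 (4 * s) {{m*n≢0 4 s}} 8) k⁸≤v)}} ⟩
      ∣ V ∣                   ∎)
    where
    open ≤-Reasoning
    open +-*-Solver
    l = ⌊log₂ ∣ V ∣ ⌋
    h = l / 4

theorem2 : ∃ λ (c₀ : ℕ) → ∃ λ (c₁ : ℕ) → ∃ λ (c₂ : ℕ) →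
    1 ≤ c₀ × 1 ≤ c₁ × 1 ≤ c₂ ×
    (∀ (m : ℕ) → ∃ λ (k : ℕ) → m ≤ k × c₀ ≤ k ×
    Σ (Graph → Set) λ 𝒢 →
    (∀ G → 𝒢 G → TreewidthAtMost G k) ×
    (∀ (N : ℕ) → ∃ λ G → 𝒢 G × N ≤ n G) ×
    (∀ G → 𝒢 G → ∀ (V : Subset (n G)) → k ^ c₁ ≤ ∣ V ∣ →
    ∃ λ (s : ℕ) → k * ⌊log₂ ∣ V ∣ ⌋ ≤ c₂ * s × PMWAtLeast G V s))
-- The exponent 8 comes from `few⇒⊥` and the divisor 16 from `width`. Taking `suc m` for s keeps s
-- positive and makes k = 4s at least m.
theorem2 = 1 , 8 , 16 , s≤s z≤n , s≤s z≤n , s≤s z≤n , λ m → let s = suc m in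
  4 * s , ≤-trans (n≤1+n m) (m≤m+n s (3 * s)) , s≤s z≤n , Family s ,
  -- Bags hold at most two nodes of 2s vertices, hence k vertices, one fewer than treewidth k
  -- permits.
  (λ { _ (member H) → Blowup.decomposition (s + s) H (≤-trans (≤-reflexive (bag s)) (n≤1+n (4 * s))) }) ,
  -- Height `N` already forces more than `N` nodes, so the class contains arbitrarily large graphs.
  (λ N → Blowup.blowup (s + s) N , member N ,
    ≤-trans (≤-trans (n≤order N) (n≤1+n (order N))) (m≤m*n (suc (order N)) (s + s))) ,
  λ { _ (member H) → width s H }
  where
  open +-*-Solver
  bag : ∀ s → 2 * (s + s) ≡ 4 * s
  bag = solve 1 (λ s → con 2 :* (s :+ s) := con 4 :* s) refl
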